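{- Let $G=\mathrm{GL}_n$ over $L$ with upper-triangular Borel $B$ and diagonal torus $T$, and let $Q=M\ltimes N$, $Q'=M'\ltimes N'$ be standard parabolic subgroups. Let $\nu\in X_*(Z_{M'})$ be a $B$-dominant cocharacter, and let $w\in{}^{Q'}W^{Q}$. Let $Q^M_{w^{ -1}}:=M\cap w^{ -1}Q'w=M_{w^{ -1}}\ltimes N_{w^{ -1}}$ (a standard parabolic of $M$) and $Q^{M'}_w:=M'\cap wQw^{ -1}=M'_w\ltimes N'_w$ (a standard parabolic of $M'$). Then $w^{ -1}\nu\in X_*(Z_{M_{w^{ -1}}})$ and $w^{ -1}\nu$ is $B\cap M$-dominant. In particular, the isomorphism $M'_w(L)\to M_{w^{ -1}}(L)$, $m\mapsto w^{ -1}mw$, restricts to a map $Z^+_{M'}\to Z^+_{M_{w^{ -1}}}$.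
   Context: $L/\mathbf Q_p$ finite with uniformiser $\varpi_L$. $W$ is the Weyl group of $(G,T)$ and ${}^{Q'}W^Q$ is the set of minimal length representatives of $W_{M'}\backslash W/W_M$. For a standard parabolic $Q''=M''\ltimes N''$ of $G$: $N''^0=N''(\mathcal O_L)$, $\overline N''^1=\ker(\overline N''(\mathcal O_L)\to\overline N''(\mathcal O_L/\varpi_L))$ for the opposite unipotent radical, $Z^+_{M''}=\{z\in Z_{M''}(L):zN''^0z^{ -1}\subseteq N''^0,\ z^{ -1}\overline N''^1z\subseteq\overline N''^1\}$. For $M_{w^{ -1}}$, $Z^+_{M_{w^{ -1}}}$ is defined in the same way with respect to the parabolic $Q^M_{w^{ -1}}$ of $M$ (using $N_{w^{ -1}}$ and its opposite inside $M$). -}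

module Defs where

open import Data.Nat using (ℕ; _≤_; _<_)
open import Data.Bool using (Bool; true; false; T; if_then_else_; _∧_)
open import Data.Fin using (Fin; toℕ)
import Data.Fin as F
open import Data.Fin.Permutation using (Permutation′; _⟨$⟩ʳ_)
open import Data.List using (map; allFin)
open import Data.Nat.ListAction using (sum)
open import Data.Integer as ℤ using (ℤ)
open import Data.Product using (_×_)
open import Data.Sum using (_⊎_)
open import Relation.Nullary.Decidable using (⌊_⌋)
open import Relation.Binary.PropositionalEquality using (_≡_)

-- A standard parabolic Q_J is given by a set J of simple roots:
-- J k = true means the simple root e_k - e_{k+1} (0-indexed) lies in the Levi.
-- (Only k < n-1 matter.)
SimpleRoots : Set
SimpleRoots = ℕ → Bool

SameBlock : {n : ℕ} → SimpleRoots → Fin n → Fin n → Set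
SameBlock J i j = ∀ k → (toℕ i ≤ k × k < toℕ j) ⊎ (toℕ j ≤ k × k < toℕ i) → T (J k)

-- Root sets: a predicate R i j means the root e_i - e_j (root group E_ij).
RootSet : ℕ → Set₁
RootSet n = Fin n → Fin n → Set

LeviRoots : {n : ℕ} → SimpleRoots → RootSet n
LeviRoots J i j = SameBlock J i j

ParRoots : {n : ℕ} → SimpleRoots → RootSet n
ParRoots J i j = (toℕ i < toℕ j) ⊎ SameBlock J i j

LeviOf : {n : ℕ} → RootSet n → RootSet n
LeviOf P i j = P i j × P j i

-- Weyl group element w (permutation σ; w e_i = e_{σ i}).
-- Conjugation: w E_ij w⁻¹ = E_{σi σj}.  So the roots of M ∩ w⁻¹ Q' w are
-- the roots (i,j) of M with (σ i, σ j) a root of Q'.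
QMwinv : {n : ℕ} → SimpleRoots → SimpleRoots → Permutation′ n → RootSet n
QMwinv J J' w i j = LeviRoots J i j × ParRoots J' (w ⟨$⟩ʳ i) (w ⟨$⟩ʳ j)

MwinvRoots : {n : ℕ} → SimpleRoots → SimpleRoots → Permutation′ n → RootSet n
MwinvRoots J J' w = LeviOf (QMwinv J J' w)

Cochar : ℕ → Set
Cochar n = Fin n → ℤ

-- ν ∈ X_*(Z_H) for a Levi H with roots R: ν is killed by every root of H,
-- i.e. ⟨e_i - e_j, ν⟩ = 0 for (i,j) ∈ R.
InCentre : {n : ℕ} → RootSet n → Cochar n → Set
InCentre R ν = ∀ i j → R i j → ν i ≡ ν j

DominantFor : {n : ℕ} → RootSet n → Cochar n → Set
DominantFor R ν = ∀ i j → toℕ i < toℕ j → R i j → ν j ℤ.≤ ν i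

BDominant : {n : ℕ} → Cochar n → Set
BDominant ν = ∀ (i j : Fin _) → toℕ i < toℕ j → ν j ℤ.≤ ν i

act⁻¹ : {n : ℕ} → Permutation′ n → Cochar n → Cochar n
act⁻¹ w ν i = ν (w ⟨$⟩ʳ i)

-- Length of a permutation = number of inversions.
inversions : {n : ℕ} → (Fin n → Fin n) → ℕ
inversions {n} σ =
  sum (map (λ i → sum (map (λ j →
    if ⌊ i F.<? j ⌋ ∧ ⌊ σ j F.<? σ i ⌋ then 1 else 0) (allFin n))) (allFin n))

InWeylLevi : {n : ℕ} → SimpleRoots → Permutation′ n → Set
InWeylLevi J u = ∀ i → SameBlock J i (u ⟨$⟩ʳ i)

MinDoubleCosetRep : {n : ℕ} → SimpleRoots → SimpleRoots → Permutation′ n → Set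
MinDoubleCosetRep {n} J' J w =
  ∀ (u v : Permutation′ n) → InWeylLevi J' u → InWeylLevi J v →
    inversions (λ i → w ⟨$⟩ʳ i) ≤ inversions (λ i → u ⟨$⟩ʳ (w ⟨$⟩ʳ (v ⟨$⟩ʳ i)))

-- A root (i, j) of the Levi of M ∩ w⁻¹Q'w is one for which both e_{wi} − e_{wj} and its negative
-- are roots of Q', i.e. w i and w j lie in one block of M', on which ν is constant.
-- Dominance for B ∩ M reduces, by chaining inside a block, to the simple roots e_k − e_{k+1} of M.
-- For those s_k ∈ W_M, and if w k > w (k+1) then w s_k has fewer inversions than w, contradicting
-- minimality in W_{M'} w W_M; so w k < w (k+1), and B-dominance gives ν_{w(k+1)} ≤ ν_{w k}.
module Submission where

open import Defs
open import Data.Nat using (ℕ)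
open import Data.Product using (_×_)
open import Data.Fin.Permutation using (Permutation′)

open import Data.Bool using (Bool; true; false; T; _∧_; if_then_else_)
open import Data.Bool.Properties using (T-∧)
open import Data.Empty using (⊥-elim)
open import Data.Fin as F using (Fin; toℕ; fromℕ<; _<_; _≤_)
import Data.Fin.Properties as FP
open import Data.Fin.Permutation using (_⟨$⟩ʳ_)
import Data.Fin.Permutation as P
open import Data.Fin.Permutation.Components using (transpose)
import Data.Integer as ℤ
import Data.Integer.Properties as ZP
open import Data.List using (map; tabulate)
import Data.Nat as ℕ
import Data.Nat.Properties as NP
open import Data.Nat.ListAction using (sum)
open import Data.Product using (_,_; uncurry)
open import Data.Sum using (_⊎_; inj₁; inj₂; reduce; swap)
open import Function using (_∘_; id; flip; Equivalence)
open import Relation.Binary using (Rel; Transitive)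
open import Relation.Binary.PropositionalEquality
open import Relation.Nullary using (¬_; yes; no)
open import Relation.Nullary.Decidable using (⌊_⌋; toWitness; fromWitness)
open import Algebra.Properties.CommutativeMonoid.Sum NP.+-0-commutativeMonoid
  using (sum-cong-≗; sum-permute) renaming (sum to ∑)

sum-map-tabulate : ∀ {A : Set} n (g : Fin n → A) (f : A → ℕ) →
  sum (map f (tabulate g)) ≡ ∑ (f ∘ g)
sum-map-tabulate ℕ.zero    g f = refl
sum-map-tabulate (ℕ.suc n) g f = cong (f (g F.zero) ℕ.+_) (sum-map-tabulate n (g ∘ F.suc) f)

∑-mono-≤ : ∀ {n} {f g : Fin n → ℕ} → (∀ i → f i ℕ.≤ g i) → ∑ f ℕ.≤ ∑ g
∑-mono-≤ {ℕ.zero}  f≤g = ℕ.z≤n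
∑-mono-≤ {ℕ.suc n} f≤g = NP.+-mono-≤ (f≤g F.zero) (∑-mono-≤ (f≤g ∘ F.suc))

∑-mono-< : ∀ {n} {f g : Fin n → ℕ} → (∀ i → f i ℕ.≤ g i) → ∀ k → f k ℕ.< g k → ∑ f ℕ.< ∑ g
∑-mono-< f≤g F.zero    fk<gk = NP.+-mono-<-≤ fk<gk (∑-mono-≤ (f≤g ∘ F.suc))
∑-mono-< f≤g (F.suc k) fk<gk = NP.+-mono-≤-< (f≤g F.zero) (∑-mono-< (f≤g ∘ F.suc) k fk<gk)

indicator : Bool → ℕ
indicator b = if b then 1 else 0

indicator-mono : ∀ {b c} → (T b → T c) → indicator b ℕ.≤ indicator c
indicator-mono {false}         _   = ℕ.z≤n
indicator-mono {true} {true}   _   = NP.≤-refl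
indicator-mono {true} {false} b⇒c = ⊥-elim (b⇒c _)

indicator-< : ∀ {b c} → ¬ T b → T c → indicator b ℕ.< indicator c
indicator-< {false} {true}  _  _ = NP.0<1+n
indicator-< {true}          ¬b _ = ⊥-elim (¬b _)

module _ {n : ℕ} (σ : Fin n → Fin n) where

  isInversion : Fin n → Fin n → Bool
  isInversion i j = ⌊ i F.<? j ⌋ ∧ ⌊ σ j F.<? σ i ⌋

  isInversion⁻ : ∀ {i j} → T (isInversion i j) → i < j × σ j < σ i
  isInversion⁻ {i} {j} t with Equivalence.to (T-∧ {⌊ i F.<? j ⌋}) t
  ... | i<j , σj<σi = toWitness i<j , toWitness σj<σi

  isInversion⁺ : ∀ {i j} → i < j → σ j < σ i → T (isInversion i j)
  isInversion⁺ {i} {j} i<j σj<σi = Equivalence.from (T-∧ {⌊ i F.<? j ⌋}) (fromWitness i<j , fromWitness σj<σi)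

  inversions≡∑∑ : inversions σ ≡ ∑ λ i → ∑ λ j → indicator (isInversion i j)
  inversions≡∑∑ = trans (sum-map-tabulate n id _) (sum-cong-≗ {n} λ _ → sum-map-tabulate n id _)

module _ {n : ℕ} (i j : Fin n) where

  transpose-view : ∀ x → (x ≡ i × transpose i j x ≡ j) ⊎ (x ≡ j × transpose i j x ≡ i)
                                ⊎ (x ≢ i × x ≢ j × transpose i j x ≡ x)
  transpose-view x with x FP.≟ i
  ... | yes x≡i = inj₁ (x≡i , refl)
  ... | no  x≢i with x FP.≟ j
  ...   | yes x≡j = inj₂ (inj₁ (x≡j , refl))
  ...   | no  x≢j = inj₂ (inj₂ (x≢i , x≢j , refl))

  transpose-matchˡ : transpose i j i ≡ j
  transpose-matchˡ with transpose-view i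
  ... | inj₁ (_ , e)          = e
  ... | inj₂ (inj₁ (i≡j , e)) = trans e i≡j
  ... | inj₂ (inj₂ (i≢i , _)) = ⊥-elim (i≢i refl)

  transpose-matchʳ : transpose i j j ≡ i
  transpose-matchʳ with transpose-view j
  ... | inj₁ (j≡i , e)            = trans e j≡i
  ... | inj₂ (inj₁ (_ , e))       = e
  ... | inj₂ (inj₂ (_ , j≢j , _)) = ⊥-elim (j≢j refl)

  transpose-involutive : ∀ x → transpose i j (transpose i j x) ≡ x
  transpose-involutive x with transpose-view x
  ... | inj₁ (refl , e)         = trans (cong (transpose i j) e) transpose-matchʳ
  ... | inj₂ (inj₁ (refl , e))  = trans (cong (transpose i j) e) transpose-matchˡ
  ... | inj₂ (inj₂ (_ , _ , e)) = trans (cong (transpose i j) e) e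

Adjacent : ∀ {n} → Fin n → Fin n → Set
Adjacent k k' = toℕ k' ≡ ℕ.suc (toℕ k)

adjacent⇒< : ∀ {n} {k k' : Fin n} → Adjacent k k' → k < k'
adjacent⇒< adj = NP.≤-reflexive (sym adj)

module AdjacentTransposition {n : ℕ} {k k' : Fin n} (adj : Adjacent k k') where

  private
    τ : Fin n → Fin n
    τ = transpose k k'

    k<k' : k < k'
    k<k' = adjacent⇒< adj

    below-k' : ∀ {x} → x < k' → x ≢ k → x < k
    below-k' x<k' x≢k = FP.≤∧≢⇒< (NP.≤-pred (subst (_ ℕ.<_) adj x<k')) x≢k

    above-k : ∀ {x} → k < x → x ≢ k' → k' < x
    above-k k<x x≢k' = FP.≤∧≢⇒< (subst (ℕ._≤ _) (sym adj) k<x) (x≢k' ∘ sym)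

  transpose-reflects-< : ∀ {a b} → τ a < τ b → a < b ⊎ (a ≡ k' × b ≡ k)
  transpose-reflects-< {a} {b} τa<τb with transpose-view k k' a | transpose-view k k' b
  ... | inj₁ (refl , _)            | inj₁ (refl , _)             = ⊥-elim (FP.<-irrefl refl τa<τb)
  ... | inj₁ (refl , _)            | inj₂ (inj₁ (refl , _))      = inj₁ k<k'
  ... | inj₁ (refl , ea)           | inj₂ (inj₂ (_ , _ , eb))    = inj₁ (FP.<-trans k<k' (subst₂ _<_ ea eb τa<τb))
  ... | inj₂ (inj₁ (refl , _))     | inj₁ (refl , _)             = inj₂ (refl , refl)
  ... | inj₂ (inj₁ (refl , _))     | inj₂ (inj₁ (refl , _))      = ⊥-elim (FP.<-irrefl refl τa<τb)
  ... | inj₂ (inj₁ (refl , ea))    | inj₂ (inj₂ (_ , b≢k' , eb)) = inj₁ (above-k (subst₂ _<_ ea eb τa<τb) b≢k')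
  ... | inj₂ (inj₂ (a≢k , _ , ea)) | inj₁ (refl , eb)            = inj₁ (below-k' (subst₂ _<_ ea eb τa<τb) a≢k)
  ... | inj₂ (inj₂ (_ , _ , ea))   | inj₂ (inj₁ (refl , eb))     = inj₁ (FP.<-trans (subst₂ _<_ ea eb τa<τb) k<k')
  ... | inj₂ (inj₂ (_ , _ , ea))   | inj₂ (inj₂ (_ , _ , eb))    = inj₁ (subst₂ _<_ ea eb τa<τb)

  -- Reindexing both sums by τ, every inversion of σ ∘ τ becomes an inversion of σ,
  -- and (k, k') is an inversion of σ but not of σ ∘ τ.
  inversions-∘-transpose-< : (σ : Fin n → Fin n) → σ k' < σ k → inversions (σ ∘ τ) ℕ.< inversions σ
  inversions-∘-transpose-< σ σk'<σk = begin-strict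
    inversions (σ ∘ τ)                                 ≡⟨ inversions≡∑∑ (σ ∘ τ) ⟩
    ∑ (λ a → ∑ λ b → inv (σ ∘ τ) a b)                  ≡⟨ sum-permute _ (P.transpose k k') ⟩
    ∑ (λ a → ∑ λ b → inv (σ ∘ τ) (τ a) b)              ≡⟨ sum-cong-≗ {n} (λ a → sum-permute _ (P.transpose k k')) ⟩
    ∑ (λ a → ∑ λ b → inv (σ ∘ τ) (τ a) (τ b))          <⟨ ∑-mono-< (λ a → ∑-mono-≤ (reindexed-≤ a)) k
                                                           (∑-mono-< (reindexed-≤ k) k' reindexed-<) ⟩
    ∑ (λ a → ∑ λ b → inv σ a b)                        ≡⟨ inversions≡∑∑ σ ⟨
    inversions σ                                       ∎
    where
      open NP.≤-Reasoning
      inv : (Fin n → Fin n) → Fin n → Fin n → ℕ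
      inv ρ a b = indicator (isInversion ρ a b)

      στ² : ∀ a → σ (τ (τ a)) ≡ σ a
      στ² a = cong σ (transpose-involutive k k' a)

      reindexed-≤ : ∀ a b → inv (σ ∘ τ) (τ a) (τ b) ℕ.≤ inv σ a b
      reindexed-≤ a b = indicator-mono λ t → inversion-of-σ (isInversion⁻ (σ ∘ τ) t)
        where
          inversion-of-σ : τ a < τ b × σ (τ (τ b)) < σ (τ (τ a)) → T (isInversion σ a b)
          inversion-of-σ (τa<τb , lt) with subst₂ _<_ (στ² b) (στ² a) lt | transpose-reflects-< τa<τb
          ... | σb<σa | inj₁ a<b           = isInversion⁺ σ a<b σb<σa
          ... | σk<σk' | inj₂ (refl , refl) = ⊥-elim (FP.<-asym σk<σk' σk'<σk)

      reindexed-< : inv (σ ∘ τ) (τ k) (τ k') ℕ.< inv σ k k'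
      reindexed-< = indicator-< not-inversion (isInversion⁺ σ k<k' σk'<σk)
        where
          not-inversion : ¬ T (isInversion (σ ∘ τ) (τ k) (τ k'))
          not-inversion t with isInversion⁻ (σ ∘ τ) t
          ... | τk<τk' , _ = FP.<-asym k<k' (subst₂ _<_ (transpose-matchˡ k k') (transpose-matchʳ k k') τk<τk')

module _ {n : ℕ} {J : SimpleRoots} where

  sameBlock-refl : ∀ {i : Fin n} → SameBlock J i i
  sameBlock-refl _ range = ⊥-elim (NP.<-irrefl refl (uncurry NP.≤-<-trans (reduce range)))

  sameBlock-sym : ∀ {i j : Fin n} → SameBlock J i j → SameBlock J j i
  sameBlock-sym i~j m = i~j m ∘ swap

  sameBlock-adjacent : ∀ {k k' : Fin n} → Adjacent k k' → T (J (toℕ k)) → SameBlock J k k'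
  sameBlock-adjacent adj Jk m (inj₁ (k≤m , m<k')) =
    subst (T ∘ J) (NP.≤-antisym k≤m (NP.≤-pred (subst (m ℕ.<_) adj m<k'))) Jk
  sameBlock-adjacent adj Jk m (inj₂ (k'≤m , m<k)) =
    ⊥-elim (NP.<-asym (adjacent⇒< adj) (NP.≤-<-trans k'≤m m<k))

  leviOf-parRoots⇒sameBlock : ∀ {i j : Fin n} → LeviOf (ParRoots J) i j → SameBlock J i j
  leviOf-parRoots⇒sameBlock (inj₂ i~j , _)        = i~j
  leviOf-parRoots⇒sameBlock (inj₁ _ , inj₂ j~i)   = sameBlock-sym j~i
  leviOf-parRoots⇒sameBlock (inj₁ i<j , inj₁ j<i) = ⊥-elim (NP.<-asym i<j j<i)

  id-inWeylLevi : InWeylLevi J (P.id {n = n})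
  id-inWeylLevi _ = sameBlock-refl

  transpose-inWeylLevi : ∀ {k k' : Fin n} → Adjacent k k' → T (J (toℕ k)) →
    InWeylLevi J (P.transpose k k')
  transpose-inWeylLevi {k} {k'} adj Jk x with transpose-view k k' x
  ... | inj₁ (refl , e)         = subst (SameBlock J x) (sym e) (sameBlock-adjacent adj Jk)
  ... | inj₂ (inj₁ (refl , e))  = subst (SameBlock J x) (sym e) (sameBlock-sym (sameBlock-adjacent adj Jk))
  ... | inj₂ (inj₂ (_ , _ , e)) = subst (SameBlock J x) (sym e) sameBlock-refl

minimalRep-ascending : ∀ {n J' J} {w : Permutation′ n} → MinDoubleCosetRep J' J w →
  ∀ {k k'} → Adjacent k k' → T (J (toℕ k)) → w ⟨$⟩ʳ k ≤ w ⟨$⟩ʳ k'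
minimalRep-ascending {J' = J'} {w = w} minimal {k} {k'} adj Jk = NP.≮⇒≥ λ wk'<wk →
  NP.<⇒≱ (AdjacentTransposition.inversions-∘-transpose-< adj (w ⟨$⟩ʳ_) wk'<wk)
         (minimal P.id (P.transpose k k') (id-inWeylLevi {J = J'}) (transpose-inWeylLevi adj Jk))

module _ {n : ℕ} {ℓ} {R : Rel (Fin n) ℓ} (R-trans : Transitive R) where

  adjacent-chain : ∀ d {i j : Fin n} → toℕ j ≡ d ℕ.+ ℕ.suc (toℕ i) →
    (∀ {k k'} → Adjacent k k' → i ≤ k → k' ≤ j → R k k') → R i j
  adjacent-chain ℕ.zero    j≡ step = step j≡ NP.≤-refl NP.≤-refl
  adjacent-chain (ℕ.suc d) {i} {j} j≡ step =
    R-trans (step adj-i NP.≤-refl i+1≤j)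
            (adjacent-chain d j≡' λ adj i+1≤k k'≤j →
              step adj (NP.≤-trans (NP.n≤1+n _) (subst (ℕ._≤ _) adj-i i+1≤k)) k'≤j)
    where
      i+1<j : ℕ.suc (toℕ i) ℕ.< toℕ j
      i+1<j = subst (ℕ.suc (toℕ i) ℕ.<_) (sym j≡) (ℕ.s≤s (NP.m≤n+m _ d))

      i+1 : Fin n
      i+1 = fromℕ< (NP.<-trans i+1<j (FP.toℕ<n j))

      adj-i : Adjacent i i+1
      adj-i = FP.toℕ-fromℕ< _

      i+1≤j : i+1 ≤ j
      i+1≤j = subst (ℕ._≤ toℕ j) (sym adj-i) (NP.<⇒≤ i+1<j)

      j≡' : toℕ j ≡ d ℕ.+ ℕ.suc (toℕ i+1)
      j≡' = trans j≡ (trans (sym (NP.+-suc d _)) (cong (λ m → d ℕ.+ ℕ.suc m) (sym adj-i)))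

  adjacent-chain-< : ∀ {i j : Fin n} → i < j →
    (∀ {k k'} → Adjacent k k' → i ≤ k → k' ≤ j → R k k') → R i j
  adjacent-chain-< {i} {j} i<j = adjacent-chain (toℕ j ℕ.∸ ℕ.suc (toℕ i)) (sym (NP.m∸n+n≡m i<j))

dominantFor-levi : ∀ {n J} {μ : Cochar n} →
  (∀ {k k'} → Adjacent k k' → T (J (toℕ k)) → μ k' ℤ.≤ μ k) → DominantFor (LeviRoots J) μ
dominantFor-levi {μ = μ} adjacent-≤ i j i<j i~j =
  adjacent-chain-< {R = λ a b → μ b ℤ.≤ μ a} (flip ZP.≤-trans) i<j
    λ adj i≤k k'≤j → adjacent-≤ adj (i~j _ (inj₁ (i≤k , NP.<-≤-trans (adjacent⇒< adj) k'≤j)))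

module _ {n : ℕ} {J J' : SimpleRoots} {ν : Cochar n} {w : Permutation′ n} where

  act⁻¹-inCentre : InCentre (LeviRoots J') ν → InCentre (MwinvRoots J J' w) (act⁻¹ w ν)
  act⁻¹-inCentre central i j ((_ , ij) , (_ , ji)) = central _ _ (leviOf-parRoots⇒sameBlock (ij , ji))

  act⁻¹-adjacent-≤ : BDominant ν → MinDoubleCosetRep J' J w →
    ∀ {k k'} → Adjacent k k' → T (J (toℕ k)) → act⁻¹ w ν k' ℤ.≤ act⁻¹ w ν k
  act⁻¹-adjacent-≤ dominant minimal adj Jk
    with NP.m≤n⇒m<n∨m≡n (minimalRep-ascending {J' = J'} {J} {w} minimal adj Jk)
  ... | inj₁ wk<wk' = dominant _ _ wk<wk'
  ... | inj₂ wk≡wk' = ZP.≤-reflexive (cong ν (FP.toℕ-injective (sym wk≡wk')))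

lemma4p17 : (n : ℕ) (J J' : SimpleRoots) (ν : Cochar n) (w : Permutation′ n) →
    InCentre (LeviRoots J') ν → BDominant ν → MinDoubleCosetRep J' J w →
    InCentre (MwinvRoots J J' w) (act⁻¹ w ν) × DominantFor (LeviRoots J) (act⁻¹ w ν)
lemma4p17 n J J' ν w central dominant minimal =
  act⁻¹-inCentre {J = J} {w = w} central ,
  dominantFor-levi (act⁻¹-adjacent-≤ {J = J} {J'} {w = w} dominant minimal)
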